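{- Let $D=(A,B,\lambda)$ be an extremally matched temporal bi-clique with $n:=|A|=|B|$. Then $D$ has a bi-spanner of size at most $$\min_{e\in\{\{a,b\}:a\in A,b\in B\}}\Big(b\big(n-\tfrac{|\mathrm{In}(e)|}{2}\big)+b\big(n-\tfrac{|\mathrm{Out}(e)|}{2}\big)+2|\mathrm{In}(e)|+2|\mathrm{Out}(e)|-3\Big).$$
   Context: A temporal bi-clique $(A,B,\lambda)$ is the complete bipartite graph with disjoint parts $A,B$ with an edge labeling $\lambda$ into $\mathbb{N}$. A path $v_1\dots v_k$ is temporal if $\lambda(\{v_i,v_{i+1}\})\le\lambda(\{v_{i+1},v_{i+2}\})$ for all $i\in[k-2]$. A bi-spanner is an edge set $S$ such that every $a\in A$ reaches every $b\in B$ by a temporal path within $S$. $b(m)$ is the minimum number such that every temporal bi-clique with $m$ vertices on each side admits a bi-spanner with at most $b(m)$ edges. For a vertex $v$ with pairwise distinct labels on its incident edges, $\pi^-(v)$ ($\pi^+(v)$) is the neighbor joined to $v$ by the edge of minimum (maximum) label; $D$ is extremally matched if these are well defined and both $\{\{v,\pi^-(v)\}\}$ and $\{\{v,\pi^+(v)\}\}$ (over all vertices $v$) are perfect matchings. For a vertex $v$ and $t\in\mathbb{N}$, $\mathrm{In}_v(t)$ is the set of vertices that reach $v$ by a temporal path all of whose labels are at most $t$, and $\mathrm{Out}_v(t)$ is the set of vertices that $v$ reaches by a temporal path all of whose labels are at least $t$ (both contain $v$). For an edge $e=\{u,v\}$, $\mathrm{In}(e)=\mathrm{In}_u(\lambda(e))\cup\mathrm{In}_v(\lambda(e))$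 and $\mathrm{Out}(e)=\mathrm{Out}_u(\lambda(e))\cup\mathrm{Out}_v(\lambda(e))$. -}

module Defs where

open import Data.Nat using (ℕ; zero; suc; _+_; _*_; _∸_; _≤_; _<_; ⌊_/2⌋)
open import Data.Fin using (Fin)
open import Data.Bool using (Bool; true; false; if_then_else_)
open import Data.List using (List; map; allFin; length)
open import Data.Nat.ListAction using (sum)
open import Data.List.Membership.Propositional using (_∈_)
open import Data.List.Relation.Unary.Unique.Propositional using (Unique)
open import Data.Product using (Σ; ∃; ∃-syntax; _×_; _,_)
open import Data.Sum using (_⊎_; inj₁; inj₂)
open import Data.Unit using (⊤)
open import Relation.Binary.PropositionalEquality using (_≡_)
open import Function.Bundles using (_⇔_)

-- A temporal bi-clique with m vertices on each side: A = Fin m, B = Fin m,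
-- and the edge {a,b} (a ∈ A, b ∈ B) carries the label  lab a b.
Labeling : ℕ → Set
Labeling m = Fin m → Fin m → ℕ

data V (m : ℕ) : Set where
  inA : Fin m → V m
  inB : Fin m → V m

EdgeSet : ℕ → Set
EdgeSet m = Fin m → Fin m → Bool

allEdges : ∀ {m} → EdgeSet m
allEdges _ _ = true

size : ∀ {m} → EdgeSet m → ℕ
size {m} S = sum (map (λ a → sum (map (λ b → if S a b then 1 else 0) (allFin m))) (allFin m))

data Step {m : ℕ} (lab : Labeling m) (S : EdgeSet m) : V m → V m → ℕ → Set where
  ab : ∀ a b → S a b ≡ true → Step lab S (inA a) (inB b) (lab a b)
  ba : ∀ a b → S a b ≡ true → Step lab S (inB b) (inA a) (lab a b)

data TWalk {m : ℕ} (lab : Labeling m) (S : EdgeSet m) (ok : ℕ → Set)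
     : ℕ → V m → V m → Set where
  nil  : ∀ {lo v} → TWalk lab S ok lo v v
  cons : ∀ {lo u w v s} → Step lab S u w s → lo ≤ s → ok s →
         TWalk lab S ok s w v → TWalk lab S ok lo u v

NoBound : ℕ → Set
NoBound _ = ⊤

Reaches : ∀ {m} → Labeling m → EdgeSet m → V m → V m → Set
Reaches lab S u v = TWalk lab S NoBound 0 u v

BiSpanner : ∀ {m} → Labeling m → EdgeSet m → Set
BiSpanner {m} lab S = ∀ (a b : Fin m) → Reaches lab S (inA a) (inB b)

IsSpannerBound : ℕ → ℕ → Set
IsSpannerBound m k = ∀ (lab : Labeling m) → ∃[ S ] (BiSpanner lab S × size S ≤ k)

IsB : ℕ → ℕ → Set
IsB m k = IsSpannerBound m k × (∀ k' → IsSpannerBound m k' → k ≤ k')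

In : ∀ {m} → Labeling m → V m → ℕ → V m → Set
In lab v t x = TWalk lab allEdges (λ s → s ≤ t) 0 x v

Out : ∀ {m} → Labeling m → V m → ℕ → V m → Set
Out lab v t x = TWalk lab allEdges NoBound t v x

InE : ∀ {m} → Labeling m → Fin m → Fin m → V m → Set
InE lab a b x = In lab (inA a) (lab a b) x ⊎ In lab (inB b) (lab a b) x

OutE : ∀ {m} → Labeling m → Fin m → Fin m → V m → Set
OutE lab a b x = Out lab (inA a) (lab a b) x ⊎ Out lab (inB b) (lab a b) x

-- xs is a duplicate-free enumeration of the set P, so |P| = length xs
Enumerates : ∀ {m} → List (V m) → (V m → Set) → Set
Enumerates xs P = Unique xs × (∀ x → (x ∈ xs) ⇔ P x)

DistinctLabels : ∀ {m} → Labeling m → Set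
DistinctLabels {m} lab =
  (∀ a b b' → lab a b ≡ lab a b' → b ≡ b') ×
  (∀ a a' b → lab a b ≡ lab a' b → a ≡ a')

-- b = π⁻(a) for a ∈ A, a = π⁻(b) for b ∈ B (as relations: minimal label)
IsMinNbrA IsMinNbrB IsMaxNbrA IsMaxNbrB : ∀ {m} → Labeling m → Fin m → Fin m → Set
IsMinNbrA {m} lab a b = ∀ (b' : Fin m) → lab a b ≤ lab a b'
IsMinNbrB {m} lab a b = ∀ (a' : Fin m) → lab a b ≤ lab a' b
IsMaxNbrA {m} lab a b = ∀ (b' : Fin m) → lab a b' ≤ lab a b
IsMaxNbrB {m} lab a b = ∀ (a' : Fin m) → lab a' b ≤ lab a b

PerfectMatching : ∀ {m} → (Fin m → Fin m → Set) → Set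
PerfectMatching {m} M =
  (∀ a → Σ (Fin m) λ b → M a b × (∀ b' → M a b' → b' ≡ b)) ×
  (∀ b → Σ (Fin m) λ a → M a b × (∀ a' → M a' b → a' ≡ a))

-- the edge set {{v, π⁻(v)}} and {{v, π⁺(v)}}
MinMatching MaxMatching : ∀ {m} → Labeling m → Fin m → Fin m → Set
MinMatching lab a b = IsMinNbrA lab a b ⊎ IsMinNbrB lab a b
MaxMatching lab a b = IsMaxNbrA lab a b ⊎ IsMaxNbrB lab a b

-- extremally matched: π⁻, π⁺ well defined (m ≥ 1, distinct incident labels)
-- and both {{v,π⁻(v)}} and {{v,π⁺(v)}} are perfect matchings
ExtremallyMatched : ∀ {m} → Labeling m → Set
ExtremallyMatched {m} lab =
  0 < m × DistinctLabels lab ×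
  PerfectMatching (MinMatching lab) × PerfectMatching (MaxMatching lab)

bound : (ℕ → ℕ) → ℕ → ℕ → ℕ → ℕ
bound b n i o = b (n ∸ ⌊ i /2⌋) + b (n ∸ ⌊ o /2⌋) + 2 * i + 2 * o ∸ 3

{-# OPTIONS --safe #-}
-- Fix an edge e = {x,y} with label t. Every vertex v lies in In(e) ∪ Out(e): compare t with
-- the label of the edge joining v to x or y. A foremost tree grown from e costs |Out(e)| − 1
-- edges, and dually for In(e); together they connect In(e) to Out(e).
-- By extremal matching Out(e) is closed under π⁺, so at most n − |Out(e)|/2 vertices of B lie
-- outside Out(e). Reaching q targets from all n sources costs only b(q) + n edges: group the
-- sources by their earliest edge into the targets and keep one source per group. Since
-- |In(e)| + |Out(e)| ≥ 2n + 1, the two extra terms n are absorbed by the bound.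
module Submission where

open import Defs
open import Data.Bool using (true; false; if_then_else_)
import Data.Bool.Properties as Bool
open import Data.Fin using (Fin; zero; suc)
import Data.Fin.Properties as Fin
open import Data.List using (List; []; _∷_; _++_; [_]; map; filter; length; lookup; allFin; cartesianProduct; replicate)
open import Data.List.Extrema.Nat using (argmin; argmax; f[argmin]≤f[xs]; f[xs]≤f[argmax])
open import Data.List.Membership.Propositional using (_∈_; _∉_; find; lose)
open import Data.List.Membership.Propositional.Properties
open import Data.List.Properties using (length-map; length-++; length-++-sucʳ; length-replicate; length-tabulate)
open import Data.List.Relation.Binary.Permutation.Propositional using (↭-sym)
open import Data.List.Relation.Binary.Permutation.Propositional.Properties using (∈-resp-↭)
open import Data.List.Relation.Unary.All as All using (All; []; _∷_)
import Data.List.Relation.Unary.All.Properties as All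
open import Data.List.Relation.Unary.AllPairs using (AllPairs; []; _∷_)
open import Data.List.Relation.Unary.Any as Any using (Any; here; there; any?)
open import Data.List.Relation.Unary.Any.Properties using (lookup-index)
open import Data.List.Relation.Unary.Sorted.TotalOrder.Properties using (Sorted⇒AllPairs)
open import Data.List.Relation.Unary.Unique.Propositional using (Unique)
import Data.List.Relation.Unary.Unique.Propositional.Properties as Unique
import Data.List.Sort as Sort
open import Data.Nat using (ℕ; zero; suc; _+_; _*_; _∸_; _≤_; _≤?_; z≤n; s≤s; ⌊_/2⌋)
open import Data.Nat.ListAction using (sum)
open import Data.Nat.Properties hiding (_≤?_)
open import Data.Nat.Tactic.RingSolver using (solve-∀)
open import Data.Product using (Σ; ∃-syntax; _×_; _,_; proj₁; proj₂)
open import Data.Product.Properties using (≡-dec)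
open import Data.Sum using (_⊎_; inj₁; inj₂)
open import Data.Unit using (tt)
open import Function using (_∘_; id)
open import Function.Bundles using (mk⇔; Equivalence)
open import Relation.Binary.Bundles using (DecTotalOrder)
import Relation.Binary.Construct.Flip.EqAndOrd as Flip
import Relation.Binary.Construct.On as On
open import Relation.Binary.Definitions using (DecidableEquality)
open import Relation.Binary.PropositionalEquality using (_≡_; refl; sym; trans; cong; cong₂; subst; subst₂)
open import Relation.Nullary using (Dec; yes; no; does; contradiction; ¬_)
open import Relation.Nullary.Decidable using (dec-true; map′; ¬?; _×-dec_)
open import Relation.Unary using (Decidable)

-- Counting with duplicate-free lists.

-- Induction on `xs`: cutting the occurrence of the head out of `ys` loses no other element of `xs`,
-- since the head does not recur in its tail.
unique-⊆⇒length-≤ : ∀ {A : Set} {xs ys : List A} → Unique xs → (∀ {x} → x ∈ xs → x ∈ ys) → length xs ≤ length ys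
unique-⊆⇒length-≤ {xs = []} _ _ = z≤n
unique-⊆⇒length-≤ {xs = x ∷ xs} u@(_ ∷ uxs) sub with ∈-∃++ (sub (here refl))
... | ys , zs , refl = subst (suc (length xs) ≤_) (sym (length-++-sucʳ ys x zs)) (s≤s (unique-⊆⇒length-≤ uxs sub′))
  where
  sub′ : ∀ {w} → w ∈ xs → w ∈ ys ++ zs
  sub′ w∈xs with ∈-++⁻ ys (sub (there w∈xs))
  ... | inj₁ w∈ys = ∈-++⁺ˡ w∈ys
  ... | inj₂ (here refl) = contradiction w∈xs (Unique.Unique[x∷xs]⇒x∉xs u)
  ... | inj₂ (there w∈zs) = ∈-++⁺ʳ ys w∈zs

enumerations-length : ∀ {m} {P : V m → Set} {xs ys : List (V m)} → Enumerates xs P → Enumerates ys P → length xs ≡ length ys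
enumerations-length (uxs , xs⇔P) (uys , ys⇔P) = ≤-antisym
  (unique-⊆⇒length-≤ uxs (λ {x} → Equivalence.from (ys⇔P x) ∘ Equivalence.to (xs⇔P x)))
  (unique-⊆⇒length-≤ uys (λ {x} → Equivalence.from (xs⇔P x) ∘ Equivalence.to (ys⇔P x)))

length-allFin : ∀ n → length (allFin n) ≡ n
length-allFin n = length-tabulate {n = n} id

opaque
  minimizer : ∀ {n} (f : Fin (suc n) → ℕ) → ∃[ i ] ∀ j → f i ≤ f j
  minimizer f = argmin f zero (allFin _) , λ j → All.lookup (f[argmin]≤f[xs] {f = f} zero (allFin _)) (∈-allFin j)

  maximizer : ∀ {n} (f : Fin (suc n) → ℕ) → ∃[ i ] ∀ j → f j ≤ f i
  maximizer f = argmax f zero (allFin _) , λ j → All.lookup (f[xs]≤f[argmax] {f = f} zero (allFin _)) (∈-allFin j)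

-- Edge sets presented as lists of edges.

Edge : ℕ → Set
Edge m = Fin m × Fin m

allPairs : ∀ m → List (Edge m)
allPairs m = cartesianProduct (allFin m) (allFin m)

∈-allPairs : ∀ {m} (e : Edge m) → e ∈ allPairs m
∈-allPairs (a , b) = ∈-cartesianProduct⁺ (∈-allFin a) (∈-allFin b)

_∈ᴱ?_ : ∀ {m} (e : Edge m) (es : List (Edge m)) → Dec (e ∈ es)
e ∈ᴱ? es = any? (≡-dec Fin._≟_ Fin._≟_ e) es

opaque
  edgeSet : ∀ {m} → List (Edge m) → EdgeSet m
  edgeSet es a b = does ((a , b) ∈ᴱ? es)

  ∈⇒edgeSet : ∀ {m} {es : List (Edge m)} {a b} → (a , b) ∈ es → edgeSet es a b ≡ true
  ∈⇒edgeSet {es = es} {a} {b} = dec-true ((a , b) ∈ᴱ? es)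

  edgeSet⇒∈ : ∀ {m} {es : List (Edge m)} {a b} → edgeSet es a b ≡ true → (a , b) ∈ es
  edgeSet⇒∈ {es = es} {a} {b} eq with (a , b) ∈ᴱ? es
  ... | yes p = p

edges : ∀ {m} → EdgeSet m → List (Edge m)
edges S = filter (λ (a , b) → S a b Bool.≟ true) (allPairs _)

∈-edges : ∀ {m} {S : EdgeSet m} {a b} → S a b ≡ true → (a , b) ∈ edges S
∈-edges {S = S} {a} {b} = ∈-filter⁺ (λ (a , b) → S a b Bool.≟ true) (∈-allPairs (a , b))

length-edges : ∀ {m} (S : EdgeSet m) → length (edges S) ≡ size S
length-edges {m} S = rows (allFin m)
  where
  P? : Decidable (λ ((a , b) : Edge m) → S a b ≡ true)
  P? (a , b) = S a b Bool.≟ true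
  row : ∀ a ys zs → length (filter P? (map (a ,_) ys ++ zs)) ≡
        sum (map (λ b → if S a b then 1 else 0) ys) + length (filter P? zs)
  row a [] zs = refl
  row a (b ∷ ys) zs with S a b
  ... | true = cong suc (row a ys zs)
  ... | false = row a ys zs
  rows : ∀ xs → length (filter P? (cartesianProduct xs (allFin m))) ≡
         sum (map (λ a → sum (map (λ b → if S a b then 1 else 0) (allFin m))) xs)
  rows [] = refl
  rows (a ∷ xs) = trans (row a (allFin m) _) (cong (_ +_) (rows xs))

-- Only an inequality, because `es` may repeat edges. It lets unions be built by `++` and their
-- sizes be bounded by adding lengths.
size-edgeSet : ∀ {m} (es : List (Edge m)) → size (edgeSet es) ≤ length es
size-edgeSet es = subst (_≤ length es) (length-edges (edgeSet es))
  (unique-⊆⇒length-≤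
    (Unique.filter⁺ P? (Unique.cartesianProduct⁺ (Unique.allFin⁺ _) (Unique.allFin⁺ _)))
    (edgeSet⇒∈ ∘ proj₂ ∘ ∈-filter⁻ P? {xs = allPairs _}))
  where
  P? : Decidable (λ (e : Edge _) → edgeSet es (proj₁ e) (proj₂ e) ≡ true)
  P? (a , b) = edgeSet es a b Bool.≟ true

-- Monotonicity and concatenation of temporal walks.

infix 4 _⊆ˢ_
_⊆ˢ_ : ∀ {m} → EdgeSet m → EdgeSet m → Set
S ⊆ˢ S′ = ∀ {a b} → S a b ≡ true → S′ a b ≡ true

edgeSet-mono : ∀ {m} {es fs : List (Edge m)} → (∀ {e} → e ∈ es → e ∈ fs) → edgeSet es ⊆ˢ edgeSet fs
edgeSet-mono sub = ∈⇒edgeSet ∘ sub ∘ edgeSet⇒∈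

Step-mono : ∀ {m} {lab : Labeling m} {S S′ u v s} → S ⊆ˢ S′ → Step lab S u v s → Step lab S′ u v s
Step-mono sub (ab a b p) = ab a b (sub p)
Step-mono sub (ba a b p) = ba a b (sub p)

TWalk-mono : ∀ {m} {lab : Labeling m} {S S′ ok ok′ lo lo′ u v} →
  S ⊆ˢ S′ → (∀ {s} → ok s → ok′ s) → lo′ ≤ lo → TWalk lab S ok lo u v → TWalk lab S′ ok′ lo′ u v
TWalk-mono sub ok⊆ lo′≤lo nil = nil
TWalk-mono {lab = lab} sub ok⊆ lo′≤lo (cons st lo≤s oks w) =
  cons (Step-mono {lab = lab} sub st) (≤-trans lo′≤lo lo≤s) (ok⊆ oks) (TWalk-mono sub ok⊆ ≤-refl w)

-- The time `r` separates the two walks: the first uses labels up to `r`, the second labels from `r`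
-- on, so the labels stay monotone at the joint.
append : ∀ {m} {lab : Labeling m} {S ok lo r u v w} → lo ≤ r → (∀ {s} → s ≤ r → ok s) →
  TWalk lab S (_≤ r) lo u v → TWalk lab S ok r v w → TWalk lab S ok lo u w
append lo≤r ok≤r nil q = TWalk-mono id id lo≤r q
append lo≤r ok≤r (cons st lo≤s s≤r p) q = cons st lo≤s (ok≤r s≤r) (append s≤r ok≤r p q)

snoc : ∀ {m} {lab : Labeling m} {S lo r s u v w} → lo ≤ s → r ≤ s →
  TWalk lab S (_≤ r) lo u v → Step lab S v w s → TWalk lab S (_≤ s) lo u w
snoc lo≤s r≤s p st = append lo≤s id (TWalk-mono id (λ x → ≤-trans x r≤s) ≤-refl p) (cons st ≤-refl ≤-refl nil)

-- Reaching few targets from all sources.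

-- Sources are grouped by their earliest first hop a → Q (M a), and each group is
-- represented by its member whose edge to that target is latest: all others reach the
-- representative before any edge of the representative has to be used.
few-targets-function : ∀ {n q k} → IsSpannerBound q k → (lab : Labeling n) (Q : Fin q → Fin n) →
  ∃[ es ] (length es ≤ k + n × (∀ a j → Reaches lab (edgeSet es) (inA a) (inB (Q j))))
few-targets-function {q = zero} _ lab Q = [] , z≤n , λ _ ()
few-targets-function {zero} {suc _} _ lab Q = [] , z≤n , λ ()
few-targets-function {n@(suc _)} {q@(suc _)} {k} spanner lab Q = es , es-length , reach
  where
  M : Fin n → Fin q
  M a = proj₁ (minimizer (λ j → lab a (Q j)))

  M-min : ∀ a j → lab a (Q (M a)) ≤ lab a (Q j)
  M-min a = proj₂ (minimizer (λ j → lab a (Q j)))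

  -- The `suc` makes every member of group `j` beat every non-member, which scores 0. Hence a
  -- maximizer lies in the group whenever the group is nonempty; for an empty group it is an
  -- arbitrary vertex.
  key : Fin q → Fin n → ℕ
  key j a = if does (M a Fin.≟ j) then suc (lab a (Q j)) else 0

  rep : Fin q → Fin n
  rep j = proj₁ (maximizer (key j))

  key-spec : ∀ a r j → M a ≡ j → key j a ≤ key j r → M r ≡ j × lab a (Q j) ≤ lab r (Q j)
  key-spec a r j eq key≤ rewrite dec-true (M a Fin.≟ j) eq with M r Fin.≟ j
  ... | yes p = p , ≤-pred key≤
  ... | no _ with () ← key≤

  rep-spec : ∀ a → M (rep (M a)) ≡ M a × lab a (Q (M a)) ≤ lab (rep (M a)) (Q (M a))
  rep-spec a = key-spec a (rep (M a)) (M a) refl (proj₂ (maximizer (key (M a))) a)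

  lab′ : Labeling q
  lab′ i j = lab (rep i) (Q j)

  S = proj₁ (spanner lab′)
  hop : Fin n → Edge n
  hop a = a , Q (M a)
  embed : Edge q → Edge n
  embed (i , j) = rep i , Q j
  es = map embed (edges S) ++ map hop (allFin n)

  es-length : length es ≤ k + n
  es-length = begin
    length es                                              ≡⟨ length-++ (map embed (edges S)) ⟩
    length (map embed (edges S)) + length (map hop (allFin n)) ≡⟨ cong₂ _+_ (length-map embed (edges S)) (length-map hop (allFin n)) ⟩
    length (edges S) + length (allFin n)                   ≡⟨ cong₂ _+_ (length-edges S) (length-allFin n) ⟩
    size S + n                                             ≤⟨ +-monoˡ-≤ n (proj₂ (proj₂ (spanner lab′))) ⟩
    k + n ∎
    where open ≤-Reasoning

  embed-∈ : ∀ {i j} → S i j ≡ true → edgeSet es (rep i) (Q j) ≡ true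
  embed-∈ p = ∈⇒edgeSet {es = es} (∈-++⁺ˡ (∈-map⁺ embed (∈-edges {S = S} p)))

  hop-∈ : ∀ a {j} → M a ≡ j → edgeSet es a (Q j) ≡ true
  hop-∈ a refl = ∈⇒edgeSet {es = es} (∈-++⁺ʳ (map embed (edges S)) (∈-map⁺ hop (∈-allFin a)))

  embedᵛ : V q → V n
  embedᵛ (inA i) = inA (rep i)
  embedᵛ (inB j) = inB (Q j)

  lift : ∀ {lo u v} → TWalk lab′ S NoBound lo u v → TWalk lab (edgeSet es) NoBound lo (embedᵛ u) (embedᵛ v)
  lift nil = nil
  lift (cons (ab i j p) lo≤s _ w) = cons (ab _ _ (embed-∈ p)) lo≤s tt (lift w)
  lift (cons (ba i j p) lo≤s _ w) = cons (ba _ _ (embed-∈ p)) lo≤s tt (lift w)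

  reach : ∀ a j → Reaches lab (edgeSet es) (inA a) (inB (Q j))
  reach a j with proj₁ (proj₂ (spanner lab′)) (M a) j | rep-spec a
  -- The walk goes from `a` to the common target `Q (M a)`, back along the hop of the
  -- representative, and then follows the lifted spanner walk. The first edge of that walk is late
  -- enough because the hop is the representative's earliest edge into the targets.
  ... | cons (ab _ j′ p) _ _ w | M-rep , a≤rep =
    cons (ab _ _ (hop-∈ a refl)) z≤n tt
      (cons (ba _ _ (hop-∈ (rep (M a)) M-rep)) a≤rep tt
        (cons (ab _ _ (embed-∈ p))
          (subst (λ i → lab (rep (M a)) (Q i) ≤ lab′ (M a) j′) M-rep (M-min (rep (M a)) j′)) tt (lift w)))

-- The targets are padded with copies of `x` to exactly `q` entries; `few-targets-function` allows
-- repeated targets.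
few-targets : ∀ {n q k} → IsSpannerBound q k → (lab : Labeling n) → Fin n → (qs : List (Fin n)) → length qs ≤ q →
  ∃[ es ] (length es ≤ k + n × (∀ a {b} → b ∈ qs → Reaches lab (edgeSet es) (inA a) (inB b)))
few-targets {n} {q} {k} spanner lab x qs |qs|≤q
  with few-targets-function (subst (λ q → IsSpannerBound q k) (sym |Q|≡q) spanner) lab (lookup Q)
  where
  Q = qs ++ replicate (q ∸ length qs) x
  |Q|≡q : length Q ≡ q
  |Q|≡q = trans (length-++ qs) (trans (cong (length qs +_) (length-replicate (q ∸ length qs))) (m+[n∸m]≡n |qs|≤q))
... | es , short , reach = es , short , λ a b∈qs →
  subst (λ b → Reaches lab (edgeSet es) (inA a) (inB b)) (sym (lookup-index (∈-++⁺ˡ b∈qs))) (reach a (Any.index (∈-++⁺ˡ b∈qs)))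

-- Vertices and oriented edges.

inA-injective : ∀ {m} {a a′ : Fin m} → inA a ≡ inA a′ → a ≡ a′
inA-injective refl = refl

inB-injective : ∀ {m} {b b′ : Fin m} → inB b ≡ inB b′ → b ≡ b′
inB-injective refl = refl

_≟ⱽ_ : ∀ {m} → DecidableEquality (V m)
inA a ≟ⱽ inA a′ = map′ (cong inA) inA-injective (a Fin.≟ a′)
inA _ ≟ⱽ inB _  = no λ ()
inB _ ≟ⱽ inA _  = no λ ()
inB b ≟ⱽ inB b′ = map′ (cong inB) inB-injective (b Fin.≟ b′)

_∈ⱽ?_ : ∀ {m} (v : V m) (vs : List (V m)) → Dec (v ∈ vs)
v ∈ⱽ? vs = any? (v ≟ⱽ_) vs

-- Separates an edge from its direction of traversal, so that tree arguments need not be repeated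
-- for the two sides.
data Ends {m : ℕ} : Edge m → V m → V m → Set where
  A→B : ∀ {a b} → Ends (a , b) (inA a) (inB b)
  B→A : ∀ {a b} → Ends (a , b) (inB b) (inA a)

Ends-sym : ∀ {m} {e : Edge m} {v w} → Ends e v w → Ends e w v
Ends-sym A→B = B→A
Ends-sym B→A = A→B

label : ∀ {m} → Labeling m → Edge m → ℕ
label lab (a , b) = lab a b

Ends⇒Step : ∀ {m} {lab : Labeling m} {es e v w} → Ends e v w → e ∈ es → Step lab (edgeSet es) v w (label lab e)
Ends⇒Step A→B e∈es = ab _ _ (∈⇒edgeSet e∈es)
Ends⇒Step B→A e∈es = ba _ _ (∈⇒edgeSet e∈es)

-- This is how distinctness of labels enters the tree construction: two edges at `v` with equal
-- labels coincide.
Ends-unique : ∀ {m} {lab : Labeling m} → DistinctLabels lab → ∀ {e e′ v w w′} →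
  Ends e v w → Ends e′ v w′ → label lab e ≡ label lab e′ → w ≡ w′
Ends-unique (distA , _) A→B A→B eq = cong inB (distA _ _ _ eq)
Ends-unique (_ , distB) B→A B→A eq = cong inA (distB _ _ _ eq)

-- Foremost trees and the set `OutE`.

Timed : ℕ → Set
Timed m = V m × ℕ

Arrives : ∀ {m} → List (Timed m) → V m → ℕ → Set
Arrives ts v s = ∃[ r ] ((v , r) ∈ ts × r ≤ s)

arrives? : ∀ {m} (ts : List (Timed m)) v s → Dec (Arrives ts v s)
arrives? ts v s = map′ to from (any? (λ (w , r) → (v ≟ⱽ w) ×-dec (r ≤? s)) ts)
  where
  to : Any (λ (w , r) → v ≡ w × r ≤ s) ts → Arrives ts v s
  to p with find p
  ... | (_ , r) , w∈ts , refl , r≤s = r , w∈ts , r≤s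
  from : Arrives ts v s → Any (λ (w , r) → v ≡ w × r ≤ s) ts
  from (_ , v∈ts , r≤s) = lose v∈ts (refl , r≤s)

-- A foremost tree grown from the edge {x,y} at its own time: each vertex carries its
-- arrival time, and no edge of the processed list L leads out of the tree.
record Tree {m} (lab : Labeling m) (x y : Fin m) (L : List (Edge m)) : Set where
  field
    timed    : List (Timed m)
    branches : List (Edge m)
    unique   : Unique (map proj₁ timed)
    count    : suc (length branches) ≡ length timed
    root∈    : (x , y) ∈ branches
    rootA    : (inA x , lab x y) ∈ timed
    rootB    : (inB y , lab x y) ∈ timed
    sound    : ∀ {v r} → (v , r) ∈ timed → TWalk lab (edgeSet branches) (_≤ r) (lab x y) (inA x) v
    early    : ∀ {v r} → (v , r) ∈ timed → lab x y ≤ r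
    prompt   : ∀ {v r} s → (v , r) ∈ timed → lab x y ≤ s → (∀ {e} → e ∈ L → label lab e ≤ s) → r ≤ s
    closed   : ∀ {e v w} → e ∈ L → Ends e v w → Arrives timed v (label lab e) → Arrives timed w (label lab e)

∈-timed⇒∈ : ∀ {m} {v : V m} {r} {ts : List (Timed m)} → (v , r) ∈ ts → v ∈ map proj₁ ts
∈-timed⇒∈ = ∈-map⁺ proj₁

∈⇒∈-timed : ∀ {m} {v : V m} {ts : List (Timed m)} → v ∈ map proj₁ ts → ∃[ r ] (v , r) ∈ ts
∈⇒∈-timed p with ∈-map⁻ proj₁ p
... | (_ , r) , q , refl = r , q

module _ {m} {lab : Labeling m} (distinct : DistinctLabels lab) (x y : Fin m) where

  sprout : Tree lab x y []
  sprout = record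
    { timed = (inA x , lab x y) ∷ (inB y , lab x y) ∷ []
    ; branches = [ (x , y) ]
    ; unique = ((λ ()) ∷ []) ∷ [] ∷ []
    -- The root edge carries two vertices; each later branch adds one edge and one vertex.
    ; count = refl
    ; root∈ = here refl
    ; rootA = here refl
    ; rootB = there (here refl)
    ; sound = λ { (here refl) → nil ; (there (here refl)) → cons (Ends⇒Step {lab = lab} A→B (here refl)) ≤-refl ≤-refl nil }
    ; early = λ { (here refl) → ≤-refl ; (there (here refl)) → ≤-refl }
    ; prompt = λ { _ (here refl) t≤s _ → t≤s ; _ (there (here refl)) t≤s _ → t≤s }
    ; closed = λ ()
    }

  -- The new vertex `w` arrives at the label of `e`, the largest so far. A processed edge at `w`
  -- could be used from then on only if it had the same label; by `Ends-unique` it then leads back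
  -- to `v`, so closedness survives.
  branch : ∀ {L e v w} → All (λ f → label lab f ≤ label lab e) L → (T : Tree lab x y L) → Ends e v w →
    Arrives (Tree.timed T) v (label lab e) → w ∉ map proj₁ (Tree.timed T) → Tree lab x y (e ∷ L)
  branch {L} {e} {v} {w} L≤e T ends (r , v∈ , r≤s) w∉ = record
    { timed = (w , s) ∷ timed
    ; branches = e ∷ branches
    ; unique = All.¬Any⇒All¬ _ w∉ ∷ unique
    ; count = cong suc count
    ; root∈ = there root∈
    ; rootA = there rootA
    ; rootB = there rootB
    ; sound = λ
      { (here refl) → snoc (≤-trans (early v∈) r≤s) r≤s (widen (sound v∈)) (Ends⇒Step {lab = lab} ends (here refl))
      ; (there p) → widen (sound p) }
    ; early = λ { (here refl) → ≤-trans (early v∈) r≤s ; (there p) → early p }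
    ; prompt = λ { _ (here refl) _ L≤ → L≤ (here refl) ; s (there p) t≤s L≤ → prompt s p t≤s (L≤ ∘ there) }
    ; closed = closed′
    }
    where
    open Tree T
    s = label lab e
    widen : ∀ {r u} → TWalk lab (edgeSet branches) (_≤ r) (lab x y) (inA x) u →
      TWalk lab (edgeSet (e ∷ branches)) (_≤ r) (lab x y) (inA x) u
    widen = TWalk-mono (edgeSet-mono there) id ≤-refl
    weaken : ∀ {u s} → Arrives timed u s → Arrives ((w , label lab e) ∷ timed) u s
    weaken (r , p , q) = r , there p , q
    v-arrives : ∀ {e′ u} → Ends e′ w u → label lab e ≤ label lab e′ → label lab e′ ≤ label lab e →
      Arrives ((w , label lab e) ∷ timed) u (label lab e′)
    v-arrives ends′ s≤s′ s′≤s with Ends-unique {lab = lab} distinct ends′ (Ends-sym ends) (≤-antisym s′≤s s≤s′)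
    ... | refl = r , there v∈ , ≤-trans r≤s s≤s′
    on-e : ∀ {v′ w′} → Ends e v′ w′ → Ends e v w → Arrives ((w , label lab e) ∷ timed) w′ (label lab e)
    on-e A→B A→B = s , here refl , ≤-refl
    on-e B→A B→A = s , here refl , ≤-refl
    on-e A→B B→A = r , there v∈ , r≤s
    on-e B→A A→B = r , there v∈ , r≤s
    closed′ : ∀ {e′ v′ w′} → e′ ∈ e ∷ L → Ends e′ v′ w′ →
      Arrives ((w , label lab e) ∷ timed) v′ (label lab e′) → Arrives ((w , label lab e) ∷ timed) w′ (label lab e′)
    closed′ (here refl) ends′ _ = on-e ends′ ends
    closed′ (there e′∈L) ends′ (r′ , here refl , s≤s′) = v-arrives ends′ s≤s′ (All.lookup L≤e e′∈L)
    closed′ (there e′∈L) ends′ (r′ , there p , r′≤) = weaken (closed e′∈L ends′ (r′ , p , r′≤))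

  -- Closedness along `e` asks for an arrival in time, not mere membership. `prompt` supplies it:
  -- arrival times in the tree never exceed the label being processed.
  skip : ∀ {L e} → All (λ f → label lab f ≤ label lab e) L → (T : Tree lab x y L) →
    (∀ {v w} → Ends e v w → Arrives (Tree.timed T) v (label lab e) → w ∈ map proj₁ (Tree.timed T)) →
    Tree lab x y (e ∷ L)
  skip {L} {e} L≤e T inside = record
    { timed = timed ; branches = branches ; unique = unique ; count = count
    ; root∈ = root∈ ; rootA = rootA ; rootB = rootB ; sound = sound ; early = early
    ; prompt = λ s p t≤s L≤ → prompt s p t≤s (L≤ ∘ there)
    ; closed = closed′ }
    where
    open Tree T
    closed′ : ∀ {e′ v w} → e′ ∈ e ∷ L → Ends e′ v w → Arrives timed v (label lab e′) → Arrives timed w (label lab e′)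
    closed′ (there e′∈L) = closed e′∈L
    closed′ (here refl) ends v-arr@(r , v∈ , r≤s) with ∈⇒∈-timed (inside ends v-arr)
    ... | r′ , w∈ = r′ , w∈ , prompt (label lab e) w∈ (≤-trans (early v∈) r≤s) (All.lookup L≤e)

  grow : ∀ L → AllPairs (λ e f → label lab f ≤ label lab e) L → Tree lab x y L
  grow [] _ = sprout
  grow (e@(a , b) ∷ L) (L≤e ∷ sorted) = extend (grow L sorted)
    where
    extend : Tree lab x y L → Tree lab x y (e ∷ L)
    -- An edge becomes a branch exactly when one end has arrived in time and the other lies outside
    -- the tree; otherwise it is skipped.
    extend T with arrives? (Tree.timed T) (inA a) (lab a b) | inB b ∈ⱽ? map proj₁ (Tree.timed T)
      | arrives? (Tree.timed T) (inB b) (lab a b) | inA a ∈ⱽ? map proj₁ (Tree.timed T)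
    ... | yes p | no q  | _     | _     = branch L≤e T A→B p q
    ... | yes _ | yes _ | yes p | no q  = branch L≤e T B→A p q
    ... | no _  | _     | yes p | no q  = branch L≤e T B→A p q
    ... | yes _ | yes p | yes _ | yes q = skip L≤e T λ { A→B _ → p ; B→A _ → q }
    ... | yes _ | yes p | no ¬q | _     = skip L≤e T λ { A→B _ → p ; B→A q → contradiction q ¬q }
    ... | no ¬p | _     | yes _ | yes q = skip L≤e T λ { A→B p → contradiction p ¬p ; B→A _ → q }
    ... | no ¬p | _     | no ¬q | _     = skip L≤e T λ { A→B p → contradiction p ¬p ; B→A q → contradiction q ¬q }

  -- Edges are processed by increasing label; grow recurses on the tail, hence the
  -- descending order.
  out-tree : ∃[ vs ] ∃[ es ] (Enumerates vs (OutE lab x y) × suc (length es) ≡ length vs × (x , y) ∈ es ×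
    (∀ {v} → v ∈ vs → TWalk lab (edgeSet es) NoBound (lab x y) (inA x) v))
  out-tree = map proj₁ timed , branches
    , (unique , λ v → mk⇔ (inj₁ ∘ TWalk-mono (λ _ → refl) _ ≤-refl ∘ walk) complete)
    , trans count (sym (length-map proj₁ timed)) , root∈ , walk
    where
    byLabel : DecTotalOrder _ _ _
    byLabel = Flip.decTotalOrder (On.decTotalOrder ≤-decTotalOrder (label lab))
    open Sort byLabel using (sort; sort-↗; sort-↭)
    T = grow (sort (allPairs m)) (Sorted⇒AllPairs (DecTotalOrder.totalOrder byLabel) (sort-↗ (allPairs m)))
    open Tree T
    closed′ : ∀ {e v w} → Ends e v w → Arrives timed v (label lab e) → Arrives timed w (label lab e)
    closed′ {e} = closed (∈-resp-↭ (↭-sym (sort-↭ (allPairs m))) (∈-allPairs e))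
    walk : ∀ {v} → v ∈ map proj₁ timed → TWalk lab (edgeSet branches) NoBound (lab x y) (inA x) v
    walk p = TWalk-mono id _ ≤-refl (sound (proj₂ (∈⇒∈-timed p)))
    delay : ∀ {v s s′} → s ≤ s′ → Arrives timed v s → Arrives timed v s′
    delay s≤s′ (r , p , r≤s) = r , p , ≤-trans r≤s s≤s′
    -- Invariant along the walk: the current vertex has arrived by the current lower bound `lo`, so
    -- closedness carries every next step.
    stays : ∀ {lo u v} → TWalk lab allEdges NoBound lo u v → Arrives timed u lo → v ∈ map proj₁ timed
    stays nil (_ , p , _) = ∈-timed⇒∈ p
    stays (cons (ab _ _ _) lo≤s _ w) arr = stays w (closed′ A→B (delay lo≤s arr))
    stays (cons (ba _ _ _) lo≤s _ w) arr = stays w (closed′ B→A (delay lo≤s arr))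
    complete : ∀ {v} → OutE lab x y v → v ∈ map proj₁ timed
    complete (inj₁ w) = stays w (_ , rootA , ≤-refl)
    complete (inj₂ w) = stays w (_ , rootB , ≤-refl)

-- Closure under maximal neighbours and the number of unreached targets.

-- Injectivity of the maximal neighbour map on the first side, given by a left inverse `ν`.
MaxNbrInjective : ∀ {n} → Labeling n → Set
MaxNbrInjective {n} lab = Σ (Fin n → Fin n) λ ν → ∀ a b → IsMaxNbrA lab a b → a ≡ ν b

maxNbr : ∀ {n} (lab : Labeling n) a → ∃[ b ] IsMaxNbrA lab a b
maxNbr {suc _} lab a = maximizer (lab a)

-- The last edge of a nonempty walk into `inA a` is incident to `a`, hence no later than the maximal
-- edge there. The hypothesis `start` covers the empty walk.
snoc-max : ∀ {n} {lab : Labeling n} {S a b lo u} → S a b ≡ true → IsMaxNbrA lab a b → (u ≡ inA a → lo ≤ lab a b) →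
  TWalk lab S NoBound lo u (inA a) → TWalk lab S NoBound lo u (inB b)
snoc-max Sab isMax start nil = cons (ab _ _ Sab) (start refl) tt nil
snoc-max {lab = lab} {S} {a} {b} Sab isMax start (cons st lo≤s _ w) = cons st lo≤s tt (snoc-max Sab isMax (arrive st) w)
  where
  arrive : ∀ {u w s} → Step lab S u w s → w ≡ inA a → s ≤ lab a b
  arrive (ba _ b′ _) refl = isMax b′

OutE-maxNbr : ∀ {n} {lab : Labeling n} {x y a b} → IsMaxNbrA lab a b → OutE lab x y (inA a) → OutE lab x y (inB b)
OutE-maxNbr {y = y} isMax (inj₁ w) = inj₁ (snoc-max refl isMax (λ { refl → isMax y }) w)
OutE-maxNbr isMax (inj₂ w) = inj₂ (snoc-max refl isMax (λ ()) w)

-- Each reached vertex of the first side is recovered by `ν` from its maximal neighbour, which is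
-- reached too. So two copies of the reached targets cover `vs`, and at least half of `length vs`
-- are reached targets.
unreached-count : ∀ {n} {lab : Labeling n} → MaxNbrInjective lab → ∀ {x y vs} → Enumerates vs (OutE lab x y) →
  length (filter (λ b → ¬? (inB b ∈ⱽ? vs)) (allFin n)) ≤ n ∸ ⌊ length vs /2⌋
unreached-count {n} {lab} (ν , ν-spec) {x} {y} {vs} (unique , vs⇔) = begin
  length unreached                                      ≤⟨ m+n≤o⇒m≤o∸n _ disjoint ⟩
  n ∸ length reached                                    ≤⟨ ∸-monoʳ-≤ n half ⟩
  n ∸ ⌊ length vs /2⌋ ∎
  where
  open ≤-Reasoning
  reached? = λ b → inB b ∈ⱽ? vs
  unreached? = λ b → ¬? (reached? b)
  reached = filter reached? (allFin n)
  unreached = filter unreached? (allFin n)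
  disjoint : length unreached + length reached ≤ n
  disjoint = begin
    length unreached + length reached   ≡⟨ length-++ unreached ⟨
    length (unreached ++ reached)       ≤⟨ unique-⊆⇒length-≤
      (Unique.++⁺ (Unique.filter⁺ unreached? (Unique.allFin⁺ n)) (Unique.filter⁺ reached? (Unique.allFin⁺ n))
        (λ (p , q) → proj₂ (∈-filter⁻ unreached? {xs = allFin n} p) (proj₂ (∈-filter⁻ reached? {xs = allFin n} q))))
      (λ {b} _ → ∈-allFin b) ⟩
    length (allFin n)                   ≡⟨ length-allFin n ⟩
    n ∎
  covered : ∀ {v} → v ∈ vs → v ∈ map inB reached ++ map (inA ∘ ν) reached
  covered {inB b} b∈vs = ∈-++⁺ˡ (∈-map⁺ inB (∈-filter⁺ reached? (∈-allFin b) b∈vs))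
  covered {inA a} a∈vs with maxNbr lab a
  ... | b , isMax = subst (λ a → inA a ∈ _) (sym (ν-spec a b isMax))
    (∈-++⁺ʳ (map inB reached) (∈-map⁺ (inA ∘ ν) (∈-filter⁺ reached? (∈-allFin b)
      (Equivalence.from (vs⇔ (inB b)) (OutE-maxNbr isMax (Equivalence.to (vs⇔ (inA a)) a∈vs))))))
  half : ⌊ length vs /2⌋ ≤ length reached
  half = begin
    ⌊ length vs /2⌋                                                     ≤⟨ ⌊n/2⌋-mono (unique-⊆⇒length-≤ unique covered) ⟩
    ⌊ length (map inB reached ++ map (inA ∘ ν) reached) /2⌋             ≡⟨ cong ⌊_/2⌋ (trans (length-++ (map inB reached))
      (cong₂ _+_ (length-map inB reached) (length-map (inA ∘ ν) reached))) ⟩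
    ⌊ length reached + length reached /2⌋                               ≡⟨ n≡⌊n+n/2⌋ (length reached) ⟨
    length reached ∎

-- The outgoing half of the spanner.

SpannerBounds : (ℕ → ℕ) → Set
SpannerBounds β = ∀ m → IsSpannerBound m (β m)

-- The tree on `k` reached vertices has `k - 1` edges, whence the `suc` in `out-half`; the bracket
-- is the cost of `few-targets` for the unreached ones.
halfBound : (ℕ → ℕ) → ℕ → ℕ → ℕ
halfBound β n k = k + (β (n ∸ ⌊ k /2⌋) + n)

opaque
  -- Targets in the tree are reached from `x` starting at the time of the root edge; the remaining
  -- targets are served from every source by `few-targets`.
  out-half : ∀ {β n} {lab : Labeling n} → SpannerBounds β → DistinctLabels lab → MaxNbrInjective lab → ∀ x y →
    ∃[ vs ] ∃[ es ] (Enumerates vs (OutE lab x y) × suc (length es) ≤ halfBound β n (length vs) × (x , y) ∈ es ×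
      (∀ b → (∀ a → Reaches lab (edgeSet es) (inA a) (inB b)) ⊎ TWalk lab (edgeSet es) NoBound (lab x y) (inA x) (inB b)))
  out-half {β} {n} {lab} spanners distinct inj x y with out-tree {lab = lab} distinct x y
  ... | vs , es , enum , |es| , xy∈es , walk
    with few-targets (spanners (n ∸ ⌊ length vs /2⌋)) lab x (filter (λ b → ¬? (inB b ∈ⱽ? vs)) (allFin n)) (unreached-count {lab = lab} inj enum)
  ... | fs , |fs| , reach = vs , es ++ fs , enum , bounded , ∈-++⁺ˡ xy∈es , connect
    where
    bounded : suc (length (es ++ fs)) ≤ halfBound β n (length vs)
    bounded rewrite length-++ es {fs} | sym |es| = +-monoʳ-≤ (suc (length es)) |fs|
    connect : ∀ b → (∀ a → Reaches lab (edgeSet (es ++ fs)) (inA a) (inB b)) ⊎ TWalk lab (edgeSet (es ++ fs)) NoBound (lab x y) (inA x) (inB b)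
    connect b with inB b ∈ⱽ? vs
    ... | yes b∈ = inj₂ (TWalk-mono (edgeSet-mono ∈-++⁺ˡ) id ≤-refl (walk b∈))
    ... | no b∉ = inj₁ λ a → TWalk-mono (edgeSet-mono (∈-++⁺ʳ es)) id ≤-refl
      (reach a (∈-filter⁺ (λ b → ¬? (inB b ∈ⱽ? vs)) (∈-allFin b) b∉))

-- Time reversal and the incoming half.

flip : ∀ {m} → V m → V m
flip (inA i) = inB i
flip (inB i) = inA i

flip-involutive : ∀ {m} (v : V m) → flip (flip v) ≡ v
flip-involutive (inA _) = refl
flip-involutive (inB _) = refl

flip-injective : ∀ {m} {v w : V m} → flip v ≡ flip w → v ≡ w
flip-injective {v = v} {w} eq = trans (sym (flip-involutive v)) (trans (cong flip eq) (flip-involutive w))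

-- Time reversal combined with exchanging the two sides.
Dual : ∀ {m} → ℕ → Labeling m → Labeling m → Set
Dual N lab lab* = ∀ a b → lab* b a + lab a b ≡ N

Dual-sym : ∀ {m N} {lab lab* : Labeling m} → Dual N lab lab* → Dual N lab* lab
Dual-sym {lab = lab} {lab*} dual b a = trans (+-comm (lab a b) (lab* b a)) (dual a b)

-- Time `s` becomes `N - s`, so lower and upper bounds trade roles; the two inequalities say this
-- without subtraction.
reverse : ∀ {m N} {lab lab* : Labeling m} {S S* lo lo* hi hi* u v} → Dual N lab lab* →
  (∀ {a b} → S a b ≡ true → S* b a ≡ true) → N ≤ hi* + lo → hi + lo* ≤ N →
  TWalk lab S (_≤ hi) lo u v → TWalk lab* S* (_≤ hi*) lo* (flip v) (flip u)
reverse _ _ _ _ nil = nil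
reverse {N = N} {lab} {lab*} {S} {S*} {lo} {lo*} {hi} {hi*} dual sub N≤ ≤N (cons st lo≤s s≤hi w) with dual-step st
  where
  dual-step : ∀ {u v s} → Step lab S u v s → ∃[ s* ] (Step lab* S* (flip v) (flip u) s* × s* + s ≡ N)
  dual-step (ab a b p) = lab* b a , ab b a (sub p) , dual a b
  dual-step (ba a b p) = lab* b a , ba b a (sub p) , dual a b
-- The first edge becomes the last. The rest has labels at least `s`, so its reversal has labels at
-- most `s*` and can be extended by that edge.
... | s* , st* , eq = TWalk-mono id (λ ≤s* → ≤-trans ≤s* s*≤hi*) ≤-refl
  (snoc lo*≤s* ≤-refl (reverse dual sub (≤-reflexive (sym eq)) ≤N w) st*)
  where
  s*≤hi* : s* ≤ hi*
  s*≤hi* = +-cancelʳ-≤ _ s* hi* (≤-trans (≤-reflexive eq) (≤-trans N≤ (+-monoʳ-≤ hi* lo≤s)))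
  lo*≤s* : lo* ≤ s*
  lo*≤s* = +-cancelʳ-≤ _ lo* s* (≤-trans (+-monoʳ-≤ lo* s≤hi) (≤-trans (≤-reflexive (+-comm lo* hi)) (≤-trans ≤N (≤-reflexive (sym eq)))))

-- Supplies the upper bound that `reverse` asks for when a walk has none.
below : ∀ {m N} {lab lab* : Labeling m} {S ok lo u v} → Dual N lab lab* → TWalk lab S ok lo u v → TWalk lab S (_≤ N) lo u v
below dual nil = nil
below {lab = lab} dual (cons st@(ab a b _) lo≤s _ w) = cons st lo≤s (m+n≤o⇒n≤o _ (≤-reflexive (dual a b))) (below dual w)
below {lab = lab} dual (cons st@(ba a b _) lo≤s _ w) = cons st lo≤s (m+n≤o⇒n≤o _ (≤-reflexive (dual a b))) (below dual w)

module _ {m N} {lab lab* : Labeling m} (dual : Dual N lab lab*) where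

  Dual-≤ : ∀ {a b a′ b′} → lab* b a ≤ lab* b′ a′ → lab a′ b′ ≤ lab a b
  Dual-≤ {a} {b} {a′} {b′} le = +-cancelˡ-≤ (lab* b a) _ _
    (≤-trans (+-monoˡ-≤ (lab a′ b′) le) (≤-reflexive (trans (dual a′ b′) (sym (dual a b)))))

  Dual-DistinctLabels : DistinctLabels lab → DistinctLabels lab*
  Dual-DistinctLabels (distA , distB) =
    (λ b a a′ eq → distB a a′ b (Dual-≡ eq)) , (λ b b′ a eq → distA a b b′ (Dual-≡ eq))
    where
    Dual-≡ : ∀ {a b a′ b′} → lab* b a ≡ lab* b′ a′ → lab a b ≡ lab a′ b′
    Dual-≡ eq = ≤-antisym (Dual-≤ (≤-reflexive (sym eq))) (Dual-≤ (≤-reflexive eq))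

  Out*⇒In : ∀ {x y u v} → Out lab* u (lab* y x) v → In lab (flip u) (lab x y) (flip v)
  Out*⇒In {x} {y} w = reverse (Dual-sym {lab = lab} dual) id
    (≤-reflexive (sym (Dual-sym {lab = lab} dual y x))) (≤-reflexive (+-identityʳ N)) (below (Dual-sym {lab = lab} dual) w)

  In⇒Out* : ∀ {x y u v} → In lab u (lab x y) v → Out lab* (flip u) (lab* y x) (flip v)
  In⇒Out* {x} {y} w = TWalk-mono id _ ≤-refl (reverse {hi* = N} dual id
    (≤-reflexive (sym (+-identityʳ N))) (≤-reflexive (Dual-sym {lab = lab} dual y x)) w)

  -- The summands trade places because `flip` exchanges the sides on which the two ends of the edge
  -- lie.
  OutE*⇒InE : ∀ {x y v} → OutE lab* y x v → InE lab x y (flip v)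
  OutE*⇒InE (inj₁ w) = inj₂ (Out*⇒In w)
  OutE*⇒InE (inj₂ w) = inj₁ (Out*⇒In w)

  InE⇒OutE* : ∀ {x y v} → InE lab x y v → OutE lab* y x (flip v)
  InE⇒OutE* (inj₁ w) = inj₂ (In⇒Out* w)
  InE⇒OutE* (inj₂ w) = inj₁ (In⇒Out* w)

  Enumerates-InE : ∀ {x y vs} → Enumerates vs (OutE lab* y x) → Enumerates (map flip vs) (InE lab x y)
  Enumerates-InE {x} {y} {vs} (unique , vs⇔) = Unique.map⁺ flip-injective unique , λ v → mk⇔ (to v) (from v)
    where
    to : ∀ v → v ∈ map flip vs → InE lab x y v
    to v p with ∈-map⁻ flip p
    ... | w , w∈vs , refl = OutE*⇒InE (Equivalence.to (vs⇔ w) w∈vs)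
    from : ∀ v → InE lab x y v → v ∈ map flip vs
    from v p = subst (_∈ map flip vs) (flip-involutive v) (∈-map⁺ flip (Equivalence.from (vs⇔ (flip v)) (InE⇒OutE* p)))

flipᴱ : ∀ {m} → Edge m → Edge m
flipᴱ (a , b) = b , a

∈-flipᴱ : ∀ {m} {es : List (Edge m)} {a b} → edgeSet es b a ≡ true → edgeSet (map flipᴱ es) a b ≡ true
∈-flipᴱ = ∈⇒edgeSet ∘ ∈-map⁺ flipᴱ ∘ edgeSet⇒∈

MinNbrInjective : ∀ {n} → Labeling n → Set
MinNbrInjective {n} lab = Σ (Fin n → Fin n) λ ν → ∀ a b → IsMinNbrB lab a b → b ≡ ν a

-- `N` is the largest label, found as the maximum of the row maxima, so the subtraction never
-- truncates.
reversal : ∀ {n} (lab : Labeling n) → ∃[ N ] ∃[ lab* ] Dual N lab lab*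
reversal {zero} lab = 0 , lab , λ ()
reversal {suc _} lab = N , (λ b a → N ∸ lab a b) , λ a b → m∸n+n≡m (≤-trans (proj₂ (maximizer (lab a)) b) (proj₂ (maximizer best) a))
  where
  best = λ a → lab a (proj₁ (maximizer (lab a)))
  N = best (proj₁ (maximizer best))

-- `out-half` for the dual labeling at the reversed edge, carried back by `reverse`. A minimal edge
-- at a vertex of the second side becomes a maximal edge at a vertex of the first.
in-half-dual : ∀ {β n N} {lab lab* : Labeling n} → Dual N lab lab* → SpannerBounds β → DistinctLabels lab → MinNbrInjective lab → ∀ x y →
  ∃[ vs ] ∃[ es ] (Enumerates vs (InE lab x y) × suc (length es) ≤ halfBound β n (length vs) × (x , y) ∈ es ×
    (∀ a → (∀ b → Reaches lab (edgeSet es) (inA a) (inB b)) ⊎ TWalk lab (edgeSet es) (_≤ lab x y) 0 (inA a) (inB y)))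
in-half-dual {β} {n} {N} {lab} {lab*} dual spanners distinct (ν , ν-spec) x y =
  let vs , es , enum , bounded , yx∈es , connect* = out-half {lab = lab*} spanners (Dual-DistinctLabels {lab = lab} dual distinct)
        (ν , λ b a isMax → ν-spec a b (λ a′ → Dual-≤ {lab = lab} dual {a′} {b} {a} {b} (isMax a′))) y x
  in
  map flip vs , map flipᴱ es , Enumerates-InE {lab = lab} dual enum
  , subst₂ (λ i j → suc i ≤ halfBound β n j) (sym (length-map flipᴱ es)) (sym (length-map flip vs)) bounded
  , ∈-map⁺ flipᴱ yx∈es , λ a → connect es (connect* a)
  where
  dual* = Dual-sym {lab = lab} dual
  connect : ∀ es {a} → (∀ b → Reaches lab* (edgeSet es) (inA b) (inB a)) ⊎ TWalk lab* (edgeSet es) NoBound (lab* y x) (inA y) (inB a) →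
    (∀ b → Reaches lab (edgeSet (map flipᴱ es)) (inA a) (inB b)) ⊎ TWalk lab (edgeSet (map flipᴱ es)) (_≤ lab x y) 0 (inA a) (inB y)
  connect es (inj₁ reach) = inj₁ λ b → TWalk-mono id _ ≤-refl
    (reverse {hi* = N} dual* ∈-flipᴱ (≤-reflexive (sym (+-identityʳ N))) (≤-reflexive (+-identityʳ N)) (below dual* (reach b)))
  connect es (inj₂ w) = inj₂ (reverse dual* ∈-flipᴱ (≤-reflexive (sym (dual* y x))) (≤-reflexive (+-identityʳ N)) (below dual* w))

in-half : ∀ {β n} {lab : Labeling n} → SpannerBounds β → DistinctLabels lab → MinNbrInjective lab → ∀ x y →
  ∃[ vs ] ∃[ es ] (Enumerates vs (InE lab x y) × suc (length es) ≤ halfBound β n (length vs) × (x , y) ∈ es ×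
    (∀ a → (∀ b → Reaches lab (edgeSet es) (inA a) (inB b)) ⊎ TWalk lab (edgeSet es) (_≤ lab x y) 0 (inA a) (inB y)))
in-half {lab = lab} = in-half-dual {lab = lab} (proj₂ (proj₂ (reversal lab)))

-- Combining the two halves.

In∪Out : ∀ {n} (lab : Labeling n) x y v → InE lab x y v ⊎ OutE lab x y v
In∪Out lab x y (inA a) with ≤-total (lab a y) (lab x y)
... | inj₁ le = inj₁ (inj₂ (cons (ab _ _ refl) z≤n le nil))
... | inj₂ ge = inj₂ (inj₂ (cons (ba _ _ refl) ge tt nil))
In∪Out lab x y (inB b) with ≤-total (lab x b) (lab x y)
... | inj₁ le = inj₁ (inj₁ (cons (ba _ _ refl) z≤n le nil))
... | inj₂ ge = inj₂ (inj₁ (cons (ab _ _ refl) ge tt nil))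

-- The endpoint x is counted twice, which pays for the "+ 1".
In+Out-count : ∀ {n} {lab : Labeling n} {x y ins outs} → Enumerates ins (InE lab x y) → Enumerates outs (OutE lab x y) →
  suc (n + n) ≤ length ins + length outs
In+Out-count {n} {lab} {x} {y} {ins} {outs} (_ , ins⇔) (_ , outs⇔)
  with ∈-∃++ (Equivalence.from (outs⇔ (inA x)) (inj₁ nil))
... | ys , zs , refl = begin
  suc (n + n)                          ≡⟨ cong suc (cong₂ _+_ (length-side inA) (length-side inB)) ⟨
  suc (length As + length Bs)          ≡⟨ cong suc (length-++ As) ⟨
  suc (length (As ++ Bs))              ≤⟨ s≤s (unique-⊆⇒length-≤ vertices-unique (λ {v} _ → covered v)) ⟩
  suc (length (ins ++ ys ++ zs))       ≡⟨ cong suc (length-++ ins) ⟩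
  suc (length ins + length (ys ++ zs)) ≡⟨ +-suc (length ins) _ ⟨
  length ins + suc (length (ys ++ zs)) ≡⟨ cong (length ins +_) (length-++-sucʳ ys (inA x) zs) ⟨
  length ins + length (ys ++ inA x ∷ zs) ∎
  where
  open ≤-Reasoning
  As = map inA (allFin n)
  Bs = map inB (allFin n)
  length-side : (f : Fin n → V n) → length (map f (allFin n)) ≡ n
  length-side f = trans (length-map f (allFin n)) (length-allFin n)
  vertices-unique : Unique (As ++ Bs)
  vertices-unique = Unique.++⁺ (Unique.map⁺ inA-injective (Unique.allFin⁺ n)) (Unique.map⁺ inB-injective (Unique.allFin⁺ n)) disjoint
    where
    disjoint : ∀ {v} → ¬ (v ∈ As × v ∈ Bs)
    disjoint (p , q) with ∈-map⁻ inA p | ∈-map⁻ inB q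
    ... | _ , _ , refl | _ , _ , ()
  covered : ∀ v → v ∈ ins ++ ys ++ zs
  covered v with In∪Out lab x y v
  ... | inj₁ p = ∈-++⁺ˡ (Equivalence.from (ins⇔ v) p)
  ... | inj₂ p with ∈-++⁻ ys (Equivalence.from (outs⇔ v) p)
  ...   | inj₁ q = ∈-++⁺ʳ ins (∈-++⁺ˡ q)
  ...   | inj₂ (there q) = ∈-++⁺ʳ ins (∈-++⁺ʳ ys q)
  -- The copy of `inA x` cut out of `outs` is still present in `ins`.
  ...   | inj₂ (here refl) = ∈-++⁺ˡ (Equivalence.from (ins⇔ (inA x)) (inj₁ nil))

-- The two halves cost at most `P + Q + i + o + 2n - 2`. Since `2n` is at most `i + o - 1`, the
-- extra terms become a second `i + o`, and the constant becomes 3.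
halfBounds≤bound : ∀ β n i o → suc (n + n) ≤ i + o → ∀ {p q} → suc p ≤ halfBound β n i → suc q ≤ halfBound β n o →
  p + q ≤ bound β n i o
halfBounds≤bound β n i o 2n<i+o {p} {q} p< q< = m+n≤o⇒m≤o∸n (p + q) (begin
  p + q + 3                                   ≡⟨ lemma₁ p q ⟩
  suc (suc p + suc q)                         ≤⟨ s≤s (+-mono-≤ p< q<) ⟩
  suc (i + (P + n) + (o + (Q + n)))           ≡⟨ lemma₂ i P n o Q ⟩
  P + Q + (i + o) + suc (n + n)               ≤⟨ +-monoʳ-≤ (P + Q + (i + o)) 2n<i+o ⟩
  P + Q + (i + o) + (i + o)                   ≡⟨ lemma₃ P Q i o ⟩
  P + Q + 2 * i + 2 * o ∎)
  where
  open ≤-Reasoning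
  P = β (n ∸ ⌊ i /2⌋)
  Q = β (n ∸ ⌊ o /2⌋)
  lemma₁ : ∀ p q → p + q + 3 ≡ suc (suc p + suc q)
  lemma₁ = solve-∀
  lemma₂ : ∀ i P n o Q → suc (i + (P + n) + (o + (Q + n))) ≡ P + Q + (i + o) + suc (n + n)
  lemma₂ = solve-∀
  lemma₃ : ∀ P Q i o → P + Q + (i + o) + (i + o) ≡ P + Q + 2 * i + 2 * o
  lemma₃ = solve-∀

opaque
  spanner-through : ∀ {β n} {lab : Labeling n} → SpannerBounds β → DistinctLabels lab → MinNbrInjective lab → MaxNbrInjective lab →
    ∀ x y → ∃[ S ] (BiSpanner lab S × (∀ ins outs → Enumerates ins (InE lab x y) → Enumerates outs (OutE lab x y) →
      size S ≤ bound β n (length ins) (length outs)))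
  spanner-through {β} {n} {lab} spanners distinct minInj maxInj x y
    with in-half {lab = lab} spanners distinct minInj x y | out-half {lab = lab} spanners distinct maxInj x y
  ... | vs , es , enum-in , es< , xy∈es , connect-in | ws , fs , enum-out , fs< , _ , connect-out = edgeSet (es ++ fs) , connect , small
    where
    fromIn : ∀ {ok lo u v} → TWalk lab (edgeSet es) ok lo u v → TWalk lab (edgeSet (es ++ fs)) ok lo u v
    fromIn = TWalk-mono (edgeSet-mono ∈-++⁺ˡ) id ≤-refl
    fromOut : ∀ {ok lo u v} → TWalk lab (edgeSet fs) ok lo u v → TWalk lab (edgeSet (es ++ fs)) ok lo u v
    fromOut = TWalk-mono (edgeSet-mono (∈-++⁺ʳ es)) id ≤-refl
    connect : BiSpanner lab (edgeSet (es ++ fs))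
    connect a b with connect-in a | connect-out b
    ... | inj₁ reach | _ = fromIn (reach b)
    ... | inj₂ _ | inj₁ reach = fromOut (reach a)
    -- The first walk ends in `inB y` by the time of the chosen edge and the second leaves `inA x`
    -- from that time on; crossing the edge from `y` to `x` joins them.
    ... | inj₂ p | inj₂ q = append z≤n _ (fromIn p)
      (cons (ba x y (∈⇒edgeSet (∈-++⁺ˡ xy∈es))) ≤-refl tt (fromOut q))
    small : ∀ ins outs → Enumerates ins (InE lab x y) → Enumerates outs (OutE lab x y) →
      size (edgeSet (es ++ fs)) ≤ bound β n (length ins) (length outs)
    small ins outs enum-ins enum-outs = begin
      size (edgeSet (es ++ fs))              ≤⟨ size-edgeSet (es ++ fs) ⟩
      length (es ++ fs)                      ≡⟨ length-++ es ⟩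
      length es + length fs                  ≤⟨ halfBounds≤bound β n (length vs) (length ws) (In+Out-count {lab = lab} enum-in enum-out) es< fs< ⟩
      bound β n (length vs) (length ws)      ≡⟨ cong₂ (bound β n) (enumerations-length enum-in enum-ins) (enumerations-length enum-out enum-outs) ⟩
      bound β n (length ins) (length outs) ∎
      where open ≤-Reasoning

theorem23 : (b : ℕ → ℕ) → (∀ m → IsB m (b m)) →
    (n : ℕ) (lab : Labeling n) → ExtremallyMatched lab →
    ∃[ S ] (BiSpanner lab S ×
    (∀ (x y : Fin n) (ins outs : List (V n)) →
    Enumerates ins (InE lab x y) → Enumerates outs (OutE lab x y) →
    size S ≤ bound b n (length ins) (length outs)))
theorem23 b isB (suc n) lab (_ , distinct , (minA , _) , (_ , maxB)) =
  -- One spanner must meet the bound for every edge, so the smallest of the spanners over all edges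
  -- is taken.
  proj₁ (spanner best) , proj₁ (proj₂ (spanner best)) ,
  λ x y ins outs enum-ins enum-outs → ≤-trans (best-least (x , y)) (proj₂ (proj₂ (spanner (x , y))) ins outs enum-ins enum-outs)
  where
  spanner : (e : Edge (suc n)) → _
  spanner (x , y) = spanner-through {lab = lab} (proj₁ ∘ isB) distinct
    -- The left inverses are the partners in the extremal matchings: a vertex whose extremal
    -- neighbour is known must be the unique partner of that neighbour.
    ((λ a → proj₁ (minA a)) , λ a b isMin → proj₂ (proj₂ (minA a)) b (inj₂ isMin))
    ((λ b → proj₁ (maxB b)) , λ a b isMax → proj₂ (proj₂ (maxB b)) a (inj₁ isMax)) x y
  cost : Edge (suc n) → ℕ
  cost e = size (proj₁ (spanner e))
  cheapest : ∃[ e ] ∀ f → cost e ≤ cost f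
  -- First the best `y` for each `x`, then the best `x` among these row minima.
  cheapest = row , λ (x , y) → ≤-trans (proj₂ (minimizer (λ x → cost (x , y* x))) x) (proj₂ (minimizer (λ y → cost (x , y))) y)
    where
    y* = λ x → proj₁ (minimizer (λ y → cost (x , y)))
    x* = proj₁ (minimizer (λ x → cost (x , y* x)))
    row = x* , y* x*
  best = proj₁ cheapest
  best-least = proj₂ cheapest
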